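{- Let $H$ be a fixed subgraph of a hypercube. If, for some integer $k \geq 1$, $H$ admits a $k$-partite representation, then \[\mathrm{ex}(Q_n, H) = o(e(Q_n)) \quad \text{as } n \to \infty,\] where $e(Q_n) = 2^{n-1} n$ is the number of edges of $Q_n$.
   Context: The hypercube $Q_n$ is the graph with vertex set $\{0,1\}^n$, two vertices being adjacent if they differ in exactly one coordinate. For graphs $G$ and $H$, $\mathrm{ex}(G,H)$ is the maximum number of edges in a subgraph of $G$ containing no copy of $H$ (no subgraph isomorphic to $H$). An edge of $Q_l$ is written as a string $[a_1 \dots a_l]$ with exactly one entry equal to $*$ (the flip-bit) and all other entries in $\{0,1\}$; it joins the two vertices obtained by replacing $*$ by $0$ and by $1$. The non-zero bits of an edge are the positions whose entry is $1$ or $*$. A subgraph $H$ of the cube has a $k$-partite representation if there is an $l$ such that: $H$ is (embedded as) a subgraph of $Q_l$; every edge of $H$ has exactly $k$ non-zero bits ($k-1$ ones and the flip-bit); and there is a function $\sigma:[l]\to[k]$ such that for each edge $e$ of $H$, $\sigma$ maps the set of positions of the non-zero bits of $e$ onto $[k]$ (i.e. no two non-zero bits of $e$ have the same image). The associated representation is the $k$-uniform hypergraph $\mathcal{H}$ on vertex set $[l]$ whose edges are the sets of positions of non-zero bits of the edges of $H$. -}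

module Defs where

open import Data.Nat using (ℕ; zero; suc; _+_; _*_; _∸_; _^_; _≤_; _≥_)
open import Data.Bool using (Bool; true; false)
open import Data.Fin using (Fin)
open import Data.Vec using (Vec; []; _∷_; lookup; map)
open import Data.List using (List; length)
open import Data.List.Membership.Propositional using (_∈_)
open import Data.List.Relation.Unary.All using (All)
open import Data.List.Relation.Unary.Any using (Any)
open import Data.List.Relation.Unary.Unique.Propositional using (Unique)
open import Data.Product using (Σ; _×_; ∃)
open import Data.Sum using (_⊎_)
open import Relation.Binary.PropositionalEquality using (_≡_)
open import Relation.Nullary using (¬_)
open import Data.Empty using (⊥)
open import Data.Unit using (⊤)

Vertex : ℕ → Set
Vertex n = Vec Bool n

-- Entries of an edge string [a_1 … a_n]: 0, 1, or the flip-bit *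
data Bit : Set where
  b0 b1 ⋆ : Bit

stars : ∀ {n} → Vec Bit n → ℕ
stars [] = 0
stars (⋆ ∷ v) = suc (stars v)
stars (b0 ∷ v) = stars v
stars (b1 ∷ v) = stars v

IsEdge : ∀ {n} → Vec Bit n → Set
IsEdge e = stars e ≡ 1

NonZeroBit : Bit → Set
NonZeroBit b0 = ⊥
NonZeroBit b1 = ⊤
NonZeroBit ⋆  = ⊤

nonZeros : ∀ {n} → Vec Bit n → ℕ
nonZeros [] = 0
nonZeros (b0 ∷ v) = nonZeros v
nonZeros (b1 ∷ v) = suc (nonZeros v)
nonZeros (⋆ ∷ v) = suc (nonZeros v)

lowBit highBit : Bit → Bool
lowBit b0 = false
lowBit b1 = true
lowBit ⋆  = false
highBit b0 = false
highBit b1 = true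
highBit ⋆  = true

lo hi : ∀ {n} → Vec Bit n → Vertex n
lo = map lowBit
hi = map highBit

Joins : ∀ {n} → Vec Bit n → Vertex n → Vertex n → Set
Joins e x y = (lo e ≡ x × hi e ≡ y) ⊎ (lo e ≡ y × hi e ≡ x)

eQ : ℕ → ℕ
eQ n = n * 2 ^ (n ∸ 1)

record SubCube (l : ℕ) : Set where
  field
    verts     : List (Vertex l)
    edges     : List (Vec Bit l)
    areEdges  : All IsEdge edges
    endpoints : All (λ e → lo e ∈ verts × hi e ∈ verts) edges
open SubCube public

-- A spanning subgraph F of Q_n given by its (distinct) edges.
record CubeSubgraph (n : ℕ) : Set where
  field
    fedges    : List (Vec Bit n)
    fAreEdges : All IsEdge fedges
    fUnique   : Unique fedges
open CubeSubgraph public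

eF : ∀ {n} → CubeSubgraph n → ℕ
eF F = length (fedges F)

ContainsCopy : ∀ {l n} → CubeSubgraph n → SubCube l → Set
ContainsCopy {l} {n} F H =
  Σ (Vertex l → Vertex n) λ φ →
    (∀ {x y} → x ∈ verts H → y ∈ verts H → φ x ≡ φ y → x ≡ y) ×
    All (λ e → Any (λ f → Joins f (φ (lo e)) (φ (hi e))) (fedges F)) (edges H)

-- p · ex(Q_n, H) ≤ e(Q_n)  (i.e. ex(Q_n,H) ≤ e(Q_n)/p), unfolding ex as a maximum
ScaledExBound : ∀ {l} → ℕ → SubCube l → ℕ → Set
ScaledExBound n H p = (F : CubeSubgraph n) → ¬ ContainsCopy F H → p * eF F ≤ eQ n

KPartite : ∀ {l} → ℕ → SubCube l → Set
KPartite {l} k H =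
  All (λ e → nonZeros e ≡ k) (edges H) ×
  Σ (Fin l → Fin k) λ σ →
    All (λ e → ∀ (a b : Fin l) → NonZeroBit (lookup e a) → NonZeroBit (lookup e b)
                 → σ a ≡ σ b → a ≡ b) (edges H)

{-# OPTIONS --safe #-}
-- Let F have at least e(Q_n)/p edges, and let d(v) be the number of directions of the F-edges at
-- v. By Markov's inequality a positive proportion of the vertices has d(v) ≥ cn, so ∑_v d(v)^k ≥
-- c′ 2^n n^k.  This sum counts the pairs (v, x) with x ∈ [n]^k a tuple of F-directions at v.
-- Substituting v = b ⊕ x, where b ⊕ x is b with the coordinates in x flipped, permutes the
-- vertices for each fixed x; hence for some b at least c′ n^k tuples x consist of F-directions at
-- b ⊕ x.  By Erdős's theorem on complete k-partite k-uniform hypergraphs this dense relation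
-- contains a box V_1 × … × V_k with |V_j| = l.  Choose g : [l] → [n] injective with
-- g(i) ∈ V_σ(i).  Then y ↦ b ⊕ g(y) embeds Q_l in Q_n, and since σ maps the non-zero positions
-- of an edge of H bijectively onto [k], every edge of H is sent into F.

module Submission where

open import Defs
open import Data.Bool using (Bool; true; false; T; _∧_; not; if_then_else_)
open import Data.Bool.ListAction using (all)
open import Data.Bool.Properties using (T-∧; ∧-assoc; ∧-identityʳ; not-involutive; not-¬)
open import Data.Fin using (Fin; zero; suc)
import Data.Fin.Properties as Fin
open import Data.List
  using (List; []; _∷_; _++_; [_]; length; map; allFin; foldr; filter; cartesianProductWith;
         cartesianProduct; tabulate)
open import Data.List.Membership.Propositional using (_∈_; _∉_; find; lose)
open import Data.List.Membership.Propositional.Properties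
  using (∈-∃++; ∈-allFin; ∈-map⁺; ∈-map⁻; ∈-tabulate⁺; ∈-tabulate⁻;
         ∈-filter⁺; ∈-cartesianProduct⁺; ∈-cartesianProductWith⁺)
open import Data.List.Properties using (length-map; length-++; ++-identityʳ; length-tabulate; map-++; map-∘; map-tabulate)
open import Data.List.Relation.Binary.Permutation.Propositional
  using (_↭_; prep; swap; ↭-sym; ↭-trans; ↭-refl; ↭-reflexive; ↭⇒↭ₛ)
import Data.List.Relation.Binary.Permutation.Propositional as Perm
open import Data.List.Relation.Binary.Permutation.Propositional.Properties
  using (shift; ∈-resp-↭; ↭-length)
import Data.List.Relation.Binary.Permutation.Propositional.Properties as Perm
import Data.List.Relation.Binary.Permutation.Setoid.Properties as PermS
open import Data.List.Relation.Binary.Subset.Propositional using (_⊆_)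
open import Data.List.Relation.Unary.All using (All; []; _∷_)
import Data.List.Relation.Unary.All as All
import Data.List.Relation.Unary.All.Properties as All
open import Data.List.Relation.Unary.Any using (Any; here; there; any?)
open import Data.List.Relation.Unary.AllPairs using ([]; _∷_)
open import Data.List.Relation.Unary.Unique.Propositional using (Unique)
import Data.List.Relation.Unary.Unique.Propositional.Properties as Unique
open import Data.Nat using (ℕ; zero; suc; _+_; _*_; _^_; _≤_; _<_; _≥_; z≤n; s≤s; _⊔_;
                             _≤?_; _≤ᵇ_; NonZero; pred; >-nonZero)
open import Data.Nat.ListAction using (sum)
open import Data.Nat.ListAction.Properties using (sum-++; sum-↭)
open import Data.Nat.Properties
open import Data.Nat.Tactic.RingSolver using (solve-∀)
open import Data.Product using (∃; ∃₂; _×_; _,_; proj₁; proj₂; ∃-syntax)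
open import Data.Sum using (inj₁; inj₂)
open import Data.Unit using (tt)
open import Data.Vec using (Vec; []; _∷_; lookup; toList; updateAt)
import Data.Vec as Vec
import Data.Vec.Properties as Vec
open import Function using (_∘_; id; Injective; Equivalence)
open import Relation.Binary.PropositionalEquality
  using (_≡_; _≢_; refl; sym; trans; cong; cong₂; subst; setoid; module ≡-Reasoning)
open import Relation.Nullary using (¬_; Dec; yes; no; contradiction; ⌊_⌋)
open import Relation.Nullary.Decidable using (toWitness; fromWitness; ¬?; T?; decidable-stable)

private
  variable
    A B C : Set

-- Finite sums

∑ : List A → (A → ℕ) → ℕ
∑ xs f = sum (map f xs)

ι : Bool → ℕ
ι b = if b then 1 else 0

count : (A → Bool) → List A → ℕ
count P xs = ∑ xs (ι ∘ P)

ι-∧ : ∀ b c → ι (b ∧ c) ≡ ι b * ι c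
ι-∧ false c = refl
ι-∧ true  c = sym (+-identityʳ (ι c))

ι≤1 : ∀ b → ι b ≤ 1
ι≤1 false = z≤n
ι≤1 true  = ≤-refl

ι-true : ∀ {b} → T b → ι b ≡ 1
ι-true {true} _ = refl

ι-pos : ∀ {b} → 0 < ι b → T b
ι-pos {true} _ = tt

∑-cong : ∀ (xs : List A) {f g : A → ℕ} → (∀ x → f x ≡ g x) → ∑ xs f ≡ ∑ xs g
∑-cong []       eq = refl
∑-cong (x ∷ xs) eq = cong₂ _+_ (eq x) (∑-cong xs eq)

∑-mono : ∀ (xs : List A) {f g : A → ℕ} → (∀ x → f x ≤ g x) → ∑ xs f ≤ ∑ xs g
∑-mono []       le = z≤n
∑-mono (x ∷ xs) le = +-mono-≤ (le x) (∑-mono xs le)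

∑-+ : ∀ (xs : List A) (f g : A → ℕ) → ∑ xs (λ x → f x + g x) ≡ ∑ xs f + ∑ xs g
∑-+ []       f g = refl
∑-+ (x ∷ xs) f g rewrite ∑-+ xs f g = interchange (f x) (g x) (∑ xs f) (∑ xs g)
  where
  interchange : ∀ a b c d → a + b + (c + d) ≡ a + c + (b + d)
  interchange = solve-∀

∑-*ˡ : ∀ (xs : List A) c (f : A → ℕ) → ∑ xs (λ x → c * f x) ≡ c * ∑ xs f
∑-*ˡ []       c f = sym (*-zeroʳ c)
∑-*ˡ (x ∷ xs) c f rewrite ∑-*ˡ xs c f = sym (*-distribˡ-+ c (f x) _)

∑-*ʳ : ∀ (xs : List A) c (f : A → ℕ) → ∑ xs (λ x → f x * c) ≡ ∑ xs f * c
∑-*ʳ []       c f = refl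
∑-*ʳ (x ∷ xs) c f rewrite ∑-*ʳ xs c f = sym (*-distribʳ-+ c (f x) _)

∑-const : ∀ (xs : List A) c → ∑ xs (λ _ → c) ≡ length xs * c
∑-const []       c = refl
∑-const (x ∷ xs) c = cong (c +_) (∑-const xs c)

∑-++ : ∀ (xs ys : List A) (f : A → ℕ) → ∑ (xs ++ ys) f ≡ ∑ xs f + ∑ ys f
∑-++ xs ys f rewrite map-++ f xs ys = sum-++ (map f xs) (map f ys)

∑-map : ∀ (xs : List A) (g : A → B) (f : B → ℕ) → ∑ (map g xs) f ≡ ∑ xs (f ∘ g)
∑-map xs g f = cong sum (sym (map-∘ xs))

∑-swap : ∀ (xs : List A) (ys : List B) (f : A → B → ℕ) →
         ∑ xs (λ x → ∑ ys (f x)) ≡ ∑ ys (λ y → ∑ xs (λ x → f x y))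
∑-swap []       ys f = sym (trans (∑-const ys 0) (*-zeroʳ (length ys)))
∑-swap (x ∷ xs) ys f rewrite ∑-swap xs ys f = sym (∑-+ ys (f x) _)

∑-cartesianProductWith : ∀ (g : A → B → C) (xs : List A) (ys : List B) (f : C → ℕ) →
  ∑ (cartesianProductWith g xs ys) f ≡ ∑ xs (λ x → ∑ ys (λ y → f (g x y)))
∑-cartesianProductWith g []       ys f = refl
∑-cartesianProductWith g (x ∷ xs) ys f = trans
  (∑-++ (map (g x) ys) _ f)
  (cong₂ _+_ (∑-map ys (g x) f) (∑-cartesianProductWith g xs ys f))

∑-↭ : ∀ {xs ys : List A} (f : A → ℕ) → xs ↭ ys → ∑ xs f ≡ ∑ ys f
∑-↭ f p = sum-↭ (Perm.map⁺ f p)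

count≤length : ∀ (P : A → Bool) xs → count P xs ≤ length xs
count≤length P xs = ≤-trans (∑-mono xs (ι≤1 ∘ P))
  (≤-reflexive (trans (∑-const xs 1) (*-identityʳ _)))

length-filter-count : ∀ (P : A → Bool) xs → length (filter (T? ∘ P) xs) ≡ count P xs
length-filter-count P [] = refl
length-filter-count P (x ∷ xs) with P x
... | false = length-filter-count P xs
... | true  = cong suc (length-filter-count P xs)

∑-pigeonhole : ∀ (xs : List A) (f : A → ℕ) c → length xs * c < ∑ xs f → ∃[ x ] x ∈ xs × c < f x
∑-pigeonhole (x ∷ xs) f c lt with c <? f x
... | yes c<fx = x , here refl , c<fx
... | no  c≮fx with y , y∈xs , c<fy ← ∑-pigeonhole xs f c
                    (+-cancelˡ-< c _ _ (<-≤-trans lt (+-monoˡ-≤ _ (≮⇒≥ c≮fx))))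
               = y , there y∈xs , c<fy

-- The points outside P account for at most half of the total m * ∑ xs d.
∑-markov : ∀ (xs : List A) (d : A → ℕ) (P : A → Bool) n m → 1 ≤ n →
           (∀ x → d x ≤ n) → (∀ x → ¬ T (P x) → m * d x ≤ n) →
           length xs * (n + n) ≤ m * ∑ xs d → length xs ≤ m * count P xs
∑-markov xs d P n m 1≤n d≤n small big =
  *-cancelʳ-≤ _ _ n {{>-nonZero 1≤n}} (+-cancelʳ-≤ (length xs * n) _ _ (begin
    length xs * n + length xs * n                    ≡⟨ *-distribˡ-+ (length xs) n n ⟨
    length xs * (n + n)                              ≤⟨ big ⟩
    m * ∑ xs d                                       ≡⟨ ∑-*ˡ xs m d ⟨
    ∑ xs (λ x → m * d x)                             ≤⟨ ∑-mono xs pointwise ⟩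
    ∑ xs (λ x → m * ι (P x) * n + n)                 ≡⟨ ∑-+ xs _ _ ⟩
    ∑ xs (λ x → m * ι (P x) * n) + ∑ xs (λ _ → n)    ≡⟨ cong₂ _+_ (∑-*ʳ xs n _) (∑-const xs n) ⟩
    ∑ xs (λ x → m * ι (P x)) * n + length xs * n     ≡⟨ cong (λ z → z * n + length xs * n) (∑-*ˡ xs m _) ⟩
    m * count P xs * n + length xs * n               ∎))
  where
  open ≤-Reasoning
  pointwise : ∀ x → m * d x ≤ m * ι (P x) * n + n
  pointwise x with P x | small x
  ... | true  | _  = ≤-trans (*-monoʳ-≤ m (d≤n x))
                       (≤-trans (≤-reflexive (cong (_* n) (sym (*-identityʳ m)))) (m≤m+n _ n))
  ... | false | le = ≤-trans (le id) (m≤n+m n _)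

-- Unique lists

∈⇒∷↭ : ∀ {x : A} {xs} → x ∈ xs → ∃[ rest ] x ∷ rest ↭ xs
∈⇒∷↭ {x = x} x∈xs with ys , zs , refl ← ∈-∃++ x∈xs = ys ++ zs , ↭-sym (shift x ys zs)

Unique-resp-↭ : ∀ {xs ys : List A} → xs ↭ ys → Unique xs → Unique ys
Unique-resp-↭ {A} p = PermS.Unique-resp-↭ (setoid A) (↭⇒↭ₛ p)

Unique-++⁻ˡ : ∀ (xs : List A) {ys} → Unique (xs ++ ys) → Unique xs
Unique-++⁻ˡ []       _         = []
Unique-++⁻ˡ (x ∷ xs) (x∉ ∷ u) = All.++⁻ˡ xs x∉ ∷ Unique-++⁻ˡ xs u

∈-∷-≢ : ∀ {x z : A} {zs} → x ≢ z → z ∈ x ∷ zs → z ∈ zs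
∈-∷-≢ x≢z (here z≡x)   = contradiction (sym z≡x) x≢z
∈-∷-≢ x≢z (there z∈zs) = z∈zs

-- The complement `rest` is returned as data, so that comparing lengths yields both the cardinality
-- bound for subsets and, for equal sizes, a permutation.
Unique-⊆⇒↭ : ∀ {xs ys : List A} → Unique xs → xs ⊆ ys → ∃[ rest ] xs ++ rest ↭ ys
Unique-⊆⇒↭ {ys = ys} []       _   = ys , ↭-refl
Unique-⊆⇒↭ {xs = x ∷ xs} {ys} (x∉xs ∷ u) sub
  with ys′ , x∷ys′↭ys ← ∈⇒∷↭ (sub (here refl))
  with rest , p ← Unique-⊆⇒↭ u (λ z∈xs →
         ∈-∷-≢ (All.lookup x∉xs z∈xs) (∈-resp-↭ (↭-sym x∷ys′↭ys) (sub (there z∈xs))))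
  = rest , ↭-trans (prep x p) x∷ys′↭ys

Unique-⊆-length : ∀ {xs ys : List A} → Unique xs → xs ⊆ ys → length xs ≤ length ys
Unique-⊆-length {xs = xs} u sub with rest , p ← Unique-⊆⇒↭ u sub =
  ≤-trans (m≤m+n _ (length rest)) (≤-reflexive (trans (sym (length-++ xs)) (↭-length p)))

Unique-⊆-↭ : ∀ {xs ys : List A} → Unique xs → xs ⊆ ys → length ys ≤ length xs → xs ↭ ys
Unique-⊆-↭ {xs = xs} {ys} u sub le with Unique-⊆⇒↭ u sub
... | []       , p = ↭-trans (↭-reflexive (sym (++-identityʳ xs))) p
... | r ∷ rest , p = contradiction le (<⇒≱ (<-≤-trans (m<m+n _ (s≤s z≤n))
        (≤-reflexive (trans (sym (length-++ xs)) (↭-length p)))))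

-- Boxes in dense k-ary relations

*-posˡ : ∀ m {n} → 0 < m * n → 0 < m
*-posˡ (suc m) _ = s≤s z≤n

*-posʳ : ∀ m {n} → 0 < m * n → 0 < n
*-posʳ m {n} pos = *-posˡ n (subst (0 <_) (*-comm m n) pos)

count-mono : ∀ {P Q : A → Bool} xs → (∀ x → T (P x) → T (Q x)) → count P xs ≤ count Q xs
count-mono {P = P} {Q} xs imp = ∑-mono xs pointwise
  where
  pointwise : ∀ x → ι (P x) ≤ ι (Q x)
  pointwise x with P x | imp x
  ... | false | _ = z≤n
  ... | true  | i = ≤-reflexive (sym (ι-true (i tt)))

-- Common neighbours in a dense bipartite relation

module _ (R : A → B → Bool) (n q : ℕ) (1≤q : 1 ≤ q) (ys : List B) where
  open ≤-Reasoning

  -- Double counting of the pairs (a, y) with `P y` and `R a y`: every such y has at least n/q + l +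
  -- 1 neighbours in `us`, while `us` has at most n elements, so some a exceeds the average
  -- `count P ys` / q. The surplus l + 1 makes the inequality strict.
  popular-element : ∀ l (P : B → Bool) (us : List A) → length us ≤ n →
    (∀ y → T (P y) → n + suc l * q ≤ q * count (λ a → R a y) us) → 1 ≤ count P ys →
    ∃[ x ] x ∈ us × count P ys < q * count (λ y → P y ∧ R x y) ys
  popular-element l P us len deg 1≤c =
    ∑-pigeonhole us (λ a → q * count (λ y → P y ∧ R a y) ys) (count P ys) (begin-strict
      length us * count P ys                           ≤⟨ *-monoˡ-≤ (count P ys) len ⟩
      n * count P ys                                   <⟨ *-monoˡ-< (count P ys) {{>-nonZero 1≤c}}
                                                            (m<m+n n (≤-trans 1≤q (m≤m+n q (l * q)))) ⟩
      (n + suc l * q) * count P ys                     ≡⟨ ∑-*ˡ ys (n + suc l * q) _ ⟨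
      ∑ ys (λ y → (n + suc l * q) * ι (P y))           ≤⟨ ∑-mono ys pointwise ⟩
      ∑ ys (λ y → q * count (λ a → P y ∧ R a y) us)    ≡⟨ ∑-*ˡ ys q _ ⟩
      q * ∑ ys (λ y → count (λ a → P y ∧ R a y) us)    ≡⟨ cong (q *_) (∑-swap ys us _) ⟩
      q * ∑ us (λ a → count (λ y → P y ∧ R a y) ys)    ≡⟨ ∑-*ˡ us q _ ⟨
      ∑ us (λ a → q * count (λ y → P y ∧ R a y) ys)    ∎)
    where
    pointwise : ∀ y → (n + suc l * q) * ι (P y) ≤ q * count (λ a → P y ∧ R a y) us
    pointwise y with P y | deg y
    ... | false | _ = ≤-trans (≤-reflexive (*-zeroʳ (n + suc l * q))) z≤n
    ... | true  | d = ≤-trans (≤-reflexive (*-identityʳ _)) (d tt)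

  degree-after-removal : ∀ l {x us us′} → x ∷ us′ ↭ us → ∀ y →
    n + suc l * q ≤ q * count (λ a → R a y) us → n + l * q ≤ q * count (λ a → R a y) us′
  degree-after-removal l {x} {us} {us′} p y deg = +-cancelˡ-≤ q _ _ (begin
    q + (n + l * q)                                  ≡⟨ rearrange q n (l * q) ⟩
    n + suc l * q                                    ≤⟨ deg ⟩
    q * count (λ a → R a y) us                       ≡⟨ cong (q *_) (∑-↭ _ p) ⟨
    q * (ι (R x y) + count (λ a → R a y) us′)        ≡⟨ *-distribˡ-+ q _ _ ⟩
    q * ι (R x y) + q * count (λ a → R a y) us′      ≤⟨ +-monoˡ-≤ _ (*-monoʳ-≤ q (ι≤1 (R x y))) ⟩
    q * 1 + q * count (λ a → R a y) us′              ≡⟨ cong (_+ q * count (λ a → R a y) us′) (*-identityʳ q) ⟩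
    q + q * count (λ a → R a y) us′                  ∎)
    where
    rearrange : ∀ a b c → a + (b + c) ≡ b + (a + c)
    rearrange = solve-∀

  -- Each choice costs a factor q and lowers every degree by at most one, whence the term l * q.
  select-common-neighbours : ∀ l (P : B → Bool) (us : List A) → length us ≤ n →
    (∀ y → T (P y) → n + l * q ≤ q * count (λ a → R a y) us) → 1 ≤ count P ys →
    ∃₂ λ fs rest → fs ++ rest ↭ us × length fs ≡ l ×
      count P ys ≤ q ^ l * count (λ y → P y ∧ all (λ a → R a y) fs) ys
  select-common-neighbours zero P us _ _ _ =
    [] , us , ↭-refl , refl ,
    ≤-reflexive (trans (∑-cong ys (λ y → cong ι (sym (∧-identityʳ (P y))))) (sym (+-identityʳ _)))
  select-common-neighbours (suc l) P us len deg 1≤c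
    with x , x∈us , c<qc ← popular-element l P us len deg 1≤c
    with us′ , x∷us′↭us ← ∈⇒∷↭ x∈us
    with fs , rest , p , refl , bound ← select-common-neighbours l (λ y → P y ∧ R x y) us′
           (≤-trans (n≤1+n _) (≤-trans (≤-reflexive (↭-length x∷us′↭us)) len))
           (λ y Py∧Rxy → degree-after-removal l x∷us′↭us y (deg y (proj₁ (Equivalence.to T-∧ Py∧Rxy))))
           (*-posʳ q (≤-trans 1≤c (<⇒≤ c<qc)))
    = x ∷ fs , rest , ↭-trans (prep x p) x∷us′↭us , refl , (begin
      count P ys
        ≤⟨ <⇒≤ c<qc ⟩
      q * count (λ y → P y ∧ R x y) ys
        ≤⟨ *-monoʳ-≤ q bound ⟩
      q * (q ^ length fs * count (λ y → (P y ∧ R x y) ∧ all (λ a → R a y) fs) ys)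
        ≡⟨ *-assoc q (q ^ length fs) _ ⟨
      q ^ suc (length fs) * count (λ y → (P y ∧ R x y) ∧ all (λ a → R a y) fs) ys
        ≡⟨ cong (q ^ suc (length fs) *_) (∑-cong ys (λ y → cong ι (∧-assoc (P y) (R x y) _))) ⟩
      q ^ suc (length fs) * count (λ y → P y ∧ all (λ a → R a y) (x ∷ fs)) ys ∎)

-- Tuples, and boxes by induction on the arity

tuples : List A → ∀ k → List (Vec A k)
tuples xs zero    = [ [] ]
tuples xs (suc k) = cartesianProductWith _∷_ xs (tuples xs k)

length-cartesianProductWith : ∀ (f : A → B → C) xs ys →
  length (cartesianProductWith f xs ys) ≡ length xs * length ys
length-cartesianProductWith f []       ys = refl
length-cartesianProductWith f (x ∷ xs) ys = trans (length-++ (map (f x) ys))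
  (cong₂ _+_ (length-map (f x) ys) (length-cartesianProductWith f xs ys))

length-tuples : ∀ (xs : List A) k → length (tuples xs k) ≡ length xs ^ k
length-tuples xs zero    = refl
length-tuples xs (suc k) = trans (length-cartesianProductWith _∷_ xs (tuples xs k))
  (cong (length xs *_) (length-tuples xs k))

length-allFin : ∀ n → length (allFin n) ≡ n
length-allFin n = length-tabulate id

T-all : ∀ (P : A → Bool) xs → T (all P xs) → ∀ {x} → x ∈ xs → T (P x)
T-all P (x ∷ xs) t (here refl) = proj₁ (Equivalence.to T-∧ t)
T-all P (x ∷ xs) t (there x∈)  = T-all P xs (proj₂ (Equivalence.to T-∧ t)) x∈

-- A complete k-partite k-uniform hypergraph inside `R`. The parts may overlap one another;
-- distinctness across parts is arranged later by choosing representatives.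
record Box {n k} (l : ℕ) (R : Vec (Fin n) k → Bool) : Set where
  field
    parts    : Vec (List (Fin n)) k
    unique   : ∀ j → Unique (lookup parts j)
    size     : ∀ j → length (lookup parts j) ≡ l
    complete : ∀ v → (∀ j → lookup v j ∈ lookup parts j) → T (R v)

-- Erdős's theorem by induction on k, with density at least 1/q. Many tails y extend by many first
-- coordinates; l of these are chosen so that a positive proportion of all tails extends by every
-- one of them, and the induction hypothesis applies to those tails. The bound `1 ≤ N` is carried
-- along because the Markov step cancels a factor n.
dense⇒box : ∀ k l q → ∃ λ N → 1 ≤ N × ∀ n → N ≤ n → (R : Vec (Fin n) k → Bool) →
            n ^ k ≤ q * count R (tuples (allFin n) k) → Box l R
dense⇒box zero l q = 1 , ≤-refl , λ n _ R dense → record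
  { parts    = []
  ; unique   = λ ()
  ; size     = λ ()
  -- For k = 0 density reads 1 ≤ q * `ι (R [])`, which forces `R []`.
  ; complete = λ { [] _ → ι-pos (subst (0 <_) (+-identityʳ (ι (R []))) (*-posʳ q dense)) }
  }
-- The factor 2 * q is lost in passing to tails of large degree, and a factor 4 * q with each of the
-- l selected first coordinates.
dense⇒box (suc k) l q with N , 1≤N , boxes ← dense⇒box k l (2 * q * (4 * q) ^ l) =
  N ⊔ l * (4 * q) , ≤-trans 1≤N (m≤m⊔n N _) , λ n N≤n R dense →
  extend n (≤-trans (m≤m⊔n N _) N≤n) (≤-trans (m≤n⊔m N _) N≤n) R dense
  where
  -- Twice the Markov multiplier 2 * q: a tail outside `P` has Q * deg y < n + l * Q ≤ 2 * n, hence
  -- 2 * q * deg y ≤ n.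
  Q = 4 * q
  module Extend (n : ℕ) (1≤n : 1 ≤ n) (lQ≤n : l * Q ≤ n) (R : Vec (Fin n) (suc k) → Bool)
    (dense : n ^ suc k ≤ q * count R (tuples (allFin n) (suc k))) where
    open ≤-Reasoning
    ys = tuples (allFin n) k

    deg : Vec (Fin n) k → ℕ
    deg y = count (λ a → R (a ∷ y)) (allFin n)

    P : Vec (Fin n) k → Bool
    P y = n + l * Q ≤ᵇ Q * deg y

    length-ys : length ys ≡ n ^ k
    length-ys = trans (length-tuples (allFin n) k) (cong (_^ k) (length-allFin n))

    small : ∀ y → ¬ T (P y) → 2 * q * deg y ≤ n
    small y ¬Py = *-cancelˡ-≤ 2 (begin
      2 * (2 * q * deg y)  ≡⟨ regroup q (deg y) ⟩
      Q * deg y            ≤⟨ <⇒≤ (≰⇒> (¬Py ∘ ≤⇒≤ᵇ)) ⟩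
      n + l * Q            ≤⟨ +-monoʳ-≤ n lQ≤n ⟩
      n + n                ≡⟨ cong (n +_) (+-identityʳ n) ⟨
      2 * n                ∎)
      where
      regroup : ∀ a b → 2 * (2 * a * b) ≡ 4 * a * b
      regroup = solve-∀

    big : length ys * (n + n) ≤ 2 * q * ∑ ys deg
    big = begin
      length ys * (n + n)                      ≡⟨ cong (_* (n + n)) length-ys ⟩
      n ^ k * (n + n)                          ≡⟨ double (n ^ k) n ⟩
      2 * n ^ suc k                            ≤⟨ *-monoʳ-≤ 2 dense ⟩
      2 * (q * count R (tuples (allFin n) (suc k)))
        ≡⟨ cong (λ z → 2 * (q * z)) (trans (∑-cartesianProductWith _∷_ (allFin n) ys (ι ∘ R))
                                           (∑-swap (allFin n) ys _)) ⟩
      2 * (q * ∑ ys deg)                       ≡⟨ *-assoc 2 q _ ⟨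
      2 * q * ∑ ys deg                         ∎
      where
      double : ∀ a b → a * (b + b) ≡ 2 * (b * a)
      double = solve-∀

    many : n ^ k ≤ 2 * q * count P ys
    many = subst (_≤ 2 * q * count P ys) length-ys
      (∑-markov ys deg P n (2 * q) 1≤n
        (λ y → ≤-trans (count≤length _ (allFin n)) (≤-reflexive (length-allFin n))) small big)

    -- As n ^ k is positive, `many` forces both q and the number of tails in `P` to be positive.
    0<2qc : 0 < 2 * q * count P ys
    0<2qc = ≤-trans (m^n>0 n {{>-nonZero 1≤n}} k) many

    1≤Q : 1 ≤ Q
    1≤Q = ≤-trans (*-posʳ 2 (*-posˡ (2 * q) 0<2qc)) (m≤m+n q _)

    selection : ∃₂ λ fs rest → fs ++ rest ↭ allFin n × length fs ≡ l ×
      count P ys ≤ Q ^ l * count (λ y → P y ∧ all (λ a → R (a ∷ y)) fs) ys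
    selection = select-common-neighbours (λ a y → R (a ∷ y)) n Q 1≤Q ys l P (allFin n)
      (≤-reflexive (length-allFin n)) (λ y → ≤ᵇ⇒≤ _ _) (*-posʳ (2 * q) 0<2qc)

    -- The degree condition `P` has served its purpose; dropping it only enlarges the set of tails.
    slice-dense : ∀ fs → count P ys ≤ Q ^ l * count (λ y → P y ∧ all (λ a → R (a ∷ y)) fs) ys →
                  n ^ k ≤ 2 * q * Q ^ l * count (λ y → all (λ a → R (a ∷ y)) fs) ys
    slice-dense fs bound = begin
      n ^ k                                                                  ≤⟨ many ⟩
      2 * q * count P ys                                                     ≤⟨ *-monoʳ-≤ (2 * q) bound ⟩
      2 * q * (Q ^ l * count (λ y → P y ∧ all (λ a → R (a ∷ y)) fs) ys)      ≤⟨ *-monoʳ-≤ (2 * q) (*-monoʳ-≤ (Q ^ l)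
                                                                                  (count-mono ys (λ y → proj₂ ∘ Equivalence.to T-∧))) ⟩
      2 * q * (Q ^ l * count (λ y → all (λ a → R (a ∷ y)) fs) ys)            ≡⟨ *-assoc (2 * q) (Q ^ l) _ ⟨
      2 * q * Q ^ l * count (λ y → all (λ a → R (a ∷ y)) fs) ys              ∎

  extend : ∀ n → N ≤ n → l * Q ≤ n → (R : Vec (Fin n) (suc k) → Bool) →
    n ^ suc k ≤ q * count R (tuples (allFin n) (suc k)) → Box l R
  extend n N≤n lQ≤n R dense with fs , rest , p , len , bound ← Extend.selection n (≤-trans 1≤N N≤n) lQ≤n R dense
    = record
    { parts    = fs ∷ parts
    ; unique   = λ { zero    → Unique-++⁻ˡ fs (Unique-resp-↭ (↭-sym p) (Unique.allFin⁺ n))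
                   ; (suc j) → unique j }
    ; size     = λ { zero → len ; (suc j) → size j }
    ; complete = λ { (a ∷ y) v∈ → T-all (λ a → R (a ∷ y)) fs (complete y (v∈ ∘ suc)) (v∈ zero) }
    }
    where
    open Box (boxes n N≤n (λ y → all (λ a → R (a ∷ y)) fs)
               (Extend.slice-dense n (≤-trans 1≤N N≤n) lQ≤n R dense fs bound))

-- Choosing distinct representatives

module _ (_≟_ : (x y : A) → Dec (x ≡ y)) where
  open import Data.List.Membership.DecPropositional _≟_ using (_∈?_)

  fresh-element : ∀ {xs} ys → Unique xs → length ys < length xs → ∃[ x ] x ∈ xs × x ∉ ys
  fresh-element {xs} ys u lt with any? (λ x → ¬? (x ∈? ys)) xs
  ... | yes p = find p
  ... | no ¬p = contradiction lt (≤⇒≯ (Unique-⊆-length u λ {z} z∈xs →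
                  decidable-stable (z ∈? ys) (λ z∉ys → ¬p (lose z∈xs z∉ys))))

  -- A greedy choice suffices: each list has at least l distinct entries, and fewer than l are taken
  -- when the next representative is chosen.
  distinct-representatives : ∀ l (S : Fin l → List A) → (∀ i → Unique (S i)) →
    (∀ i → l ≤ length (S i)) → ∃[ g ] Injective _≡_ _≡_ g × (∀ i → g i ∈ S i)
  distinct-representatives zero    S u len = (λ ()) , (λ {i} → contradiction i λ ()) , λ ()
  distinct-representatives (suc l) S u len
    with g , g-inj , g∈ ← distinct-representatives l (S ∘ suc) (u ∘ suc) (λ i → ≤-trans (n≤1+n l) (len (suc i)))
    with x , x∈ , x∉g ← fresh-element (tabulate g) (u zero) (subst (_< length (S zero)) (sym (length-tabulate g)) (len zero))
    = h , h-inj , λ { zero → x∈ ; (suc i) → g∈ i }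
    where
    h : Fin (suc l) → A
    h zero    = x
    h (suc i) = g i

    h-inj : Injective _≡_ _≡_ h
    h-inj {zero}  {zero}  _  = refl
    h-inj {zero}  {suc j} eq = contradiction (subst (_∈ tabulate g) (sym eq) (∈-tabulate⁺ j)) x∉g
    h-inj {suc i} {zero}  eq = contradiction (subst (_∈ tabulate g) eq (∈-tabulate⁺ i)) x∉g
    h-inj {suc i} {suc j} eq = cong suc (g-inj eq)

-- Transversals of a colouring

InjectiveOn : List A → (A → B) → Set
InjectiveOn xs f = ∀ {x y} → x ∈ xs → y ∈ xs → f x ≡ f y → x ≡ y

Unique-map⁺ : ∀ {xs : List A} {f : A → B} → InjectiveOn xs f → Unique xs → Unique (map f xs)
Unique-map⁺ inj []         = []
Unique-map⁺ inj (x∉xs ∷ u) =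
  All.map⁺ (All.tabulate λ y∈xs eq → All.lookup x∉xs y∈xs (inj (here refl) (there y∈xs) eq))
  ∷ Unique-map⁺ (λ x∈ y∈ → inj (there x∈) (there y∈)) u

-- An injective colouring of k elements by k colours is a bijection, and `τ` is its inverse. Applied
-- to the non-zero positions of an edge, it lists them by colour, which is the order in which a box
-- expects its coordinates.
transversal : ∀ {k} {xs : List A} (σ : A → Fin k) → Unique xs → length xs ≡ k → InjectiveOn xs σ →
              ∃[ τ ] (∀ j → σ (τ j) ≡ j) × tabulate τ ↭ xs
transversal {A = A} {k} {xs} σ u len inj = τ , σ∘τ , Unique-⊆-↭ (Unique.tabulate⁺ τ-inj) τ⊆xs
    (≤-reflexive (trans len (sym (length-tabulate τ))))
  where
  open import Data.List.Membership.DecPropositional (Fin._≟_ {k}) using (_∈?_)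

  hit : ∀ j → ∃[ x ] x ∈ xs × j ≡ σ x
  hit j with j ∈? map σ xs
  ... | yes j∈ = ∈-map⁻ σ j∈
  -- A missed colour j together with the k colours in the image would give k + 1 distinct elements
  -- of `Fin k`.
  ... | no  j∉ = contradiction
    (Unique-⊆-length (All.¬Any⇒All¬ _ j∉ ∷ Unique-map⁺ inj u) (λ {i} _ → ∈-allFin i))
    (<⇒≱ (s≤s (≤-reflexive (trans (length-allFin k) (trans (sym len) (sym (length-map σ xs)))))))

  τ : Fin k → A
  τ j = proj₁ (hit j)

  σ∘τ : ∀ j → σ (τ j) ≡ j
  σ∘τ j = sym (proj₂ (proj₂ (hit j)))

  τ-inj : ∀ {i j} → τ i ≡ τ j → i ≡ j
  τ-inj {i} {j} eq = trans (sym (σ∘τ i)) (trans (cong σ eq) (σ∘τ j))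

  τ⊆xs : tabulate τ ⊆ xs
  τ⊆xs x∈ with j , refl ← ∈-tabulate⁻ x∈ = proj₁ (proj₂ (hit j))

-- Flipping coordinates of the cube

flip : ∀ {n} → Fin n → Vertex n → Vertex n
flip i v = updateAt v i not

flips : ∀ {n} → List (Fin n) → Vertex n → Vertex n
flips xs v = foldr flip v xs

flip-involutive : ∀ {n} (i : Fin n) v → flip i (flip i v) ≡ v
flip-involutive i v = trans (Vec.updateAt-updateAt i v)
  (Vec.updateAt-id-local i v (not-involutive (lookup v i)))

flip-injective : ∀ {n} (i : Fin n) {v w} → flip i v ≡ flip i w → v ≡ w
flip-injective i {v} {w} eq =
  trans (sym (flip-involutive i v)) (trans (cong (flip i) eq) (flip-involutive i w))

flip-comm : ∀ {n} (i j : Fin n) v → flip i (flip j v) ≡ flip j (flip i v)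
flip-comm i j v with i Fin.≟ j
... | yes refl = refl
... | no  i≢j  = Vec.updateAt-commutes i j i≢j v

-- Flips commute, so b ⊕ x ignores the order of x. This lets the directions of an edge be listed by
-- colour or by position at will.
flips-↭ : ∀ {n} {xs ys : List (Fin n)} → xs ↭ ys → ∀ v → flips xs v ≡ flips ys v
flips-↭ Perm.refl          v = refl
flips-↭ (prep x p)         v = cong (flip x) (flips-↭ p v)
flips-↭ {ys = _ ∷ _ ∷ ys} (swap x y p) v =
  trans (cong (flip x ∘ flip y) (flips-↭ p v)) (flip-comm x y (flips ys v))
flips-↭ (Perm.trans p q)   v = trans (flips-↭ p v) (flips-↭ q v)

vertices : ∀ n → List (Vertex n)
vertices = tuples (false ∷ true ∷ [])

∈-vertices : ∀ {n} (v : Vertex n) → v ∈ vertices n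
∈-vertices []          = here refl
∈-vertices (false ∷ v) = ∈-cartesianProductWith⁺ _∷_ {xs = false ∷ true ∷ []} (here refl) (∈-vertices v)
∈-vertices (true  ∷ v) = ∈-cartesianProductWith⁺ _∷_ {xs = false ∷ true ∷ []} (there (here refl)) (∈-vertices v)

-- A flip permutes the vertices: in the first coordinate it exchanges the two halves of the cube, in
-- a later one it acts inside each half.
∑-flip : ∀ {n} (i : Fin n) (h : Vertex n → ℕ) → ∑ (vertices n) (h ∘ flip i) ≡ ∑ (vertices n) h
∑-flip {suc n} i h = trans (∑-cartesianProductWith _∷_ (false ∷ true ∷ []) (vertices n) _)
  (trans (split i) (sym (∑-cartesianProductWith _∷_ (false ∷ true ∷ []) (vertices n) h)))
  where
  half : Bool → ℕ
  half b = ∑ (vertices n) (λ v → h (b ∷ v))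

  swap-summands : ∀ a b → a + (b + 0) ≡ b + (a + 0)
  swap-summands = solve-∀

  split : ∀ i → ∑ (false ∷ true ∷ []) (λ b → ∑ (vertices n) (λ v → h (flip i (b ∷ v))))
                ≡ ∑ (false ∷ true ∷ []) half
  split zero    = swap-summands (half true) (half false)
  split (suc i) = ∑-cong (false ∷ true ∷ []) (λ b → ∑-flip i (λ v → h (b ∷ v)))

∑-flips : ∀ {n} (xs : List (Fin n)) (h : Vertex n → ℕ) → ∑ (vertices n) (h ∘ flips xs) ≡ ∑ (vertices n) h
∑-flips []       h = refl
∑-flips (x ∷ xs) h = trans (∑-flips xs (h ∘ flip x)) (∑-flip x h)

-- A base vertex with many good tuples of directions

count-all-tuples : ∀ (D : A → Bool) xs k → count (all D ∘ toList) (tuples xs k) ≡ count D xs ^ k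
count-all-tuples D xs zero    = refl
count-all-tuples D xs (suc k) = begin
  count (all D ∘ toList) (tuples xs (suc k))
    ≡⟨ ∑-cartesianProductWith _∷_ xs (tuples xs k) _ ⟩
  ∑ xs (λ a → ∑ (tuples xs k) (λ y → ι (D a ∧ all D (toList y))))
    ≡⟨ ∑-cong xs (λ a → trans (∑-cong (tuples xs k) (λ y → ι-∧ (D a) _)) (∑-*ˡ (tuples xs k) (ι (D a)) _)) ⟩
  ∑ xs (λ a → ι (D a) * count (all D ∘ toList) (tuples xs k))
    ≡⟨ ∑-*ʳ xs _ (ι ∘ D) ⟩
  count D xs * count (all D ∘ toList) (tuples xs k)
    ≡⟨ cong (count D xs *_) (count-all-tuples D xs k) ⟩
  count D xs ^ suc k ∎
  where open ≡-Reasoning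

^-distribʳ-* : ∀ m n k → (m * n) ^ k ≡ m ^ k * n ^ k
^-distribʳ-* m n zero    = refl
^-distribʳ-* m n (suc k) = trans (cong (m * n *_) (^-distribʳ-* m n k)) (interchange m n (m ^ k) (n ^ k))
  where
  interchange : ∀ a b c d → a * b * (c * d) ≡ a * c * (b * d)
  interchange = solve-∀

-- The tuple x is good for b if every edge at b ⊕ x in a direction of x is selected by D.
good : ∀ {n k} → (Vertex n → Fin n → Bool) → Vertex n → Vec (Fin n) k → Bool
good D b x = all (D (flips (toList x) b)) (toList x)

degree : ∀ {n} → (Vertex n → Fin n → Bool) → Vertex n → ℕ
degree {n} D v = count (D v) (allFin n)

module _ {n : ℕ} (D : Vertex n → Fin n → Bool) (k : ℕ) where
  private
    V = vertices n
    X = tuples (allFin n) k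

  length-vertices : length V ≡ 2 ^ n
  length-vertices = length-tuples (false ∷ true ∷ []) n

  -- For fixed x the map b ↦ b ⊕ x permutes the vertices.
  ∑-good : ∑ V (λ b → count (good D b) X) ≡ ∑ V (λ v → degree D v ^ k)
  ∑-good = begin
    ∑ V (λ b → count (good D b) X)
      ≡⟨ ∑-swap V X _ ⟩
    ∑ X (λ x → ∑ V (λ b → ι (good D b x)))
      ≡⟨ ∑-cong X (λ x → ∑-flips (toList x) (λ v → ι (all (D v) (toList x)))) ⟩
    ∑ X (λ x → ∑ V (λ v → ι (all (D v) (toList x))))
      ≡⟨ ∑-swap X V _ ⟩
    ∑ V (λ v → count (all (D v) ∘ toList) X)
      ≡⟨ ∑-cong V (λ v → count-all-tuples (D v) (allFin n) k) ⟩
    ∑ V (λ v → degree D v ^ k) ∎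
    where open ≡-Reasoning

  module _ (q : ℕ) (1≤n : 1 ≤ n) (dense : 2 ^ n * n ≤ q * ∑ V (degree D)) where
    open ≤-Reasoning

    P : Vertex n → Bool
    P v = n ≤ᵇ 2 * q * degree D v

    -- The mean degree is at least n/q, so vertices of degree below n/(2q) carry at most half of the
    -- degree sum. The rest lies on vertices of `P`, each carrying at most n.
    many-rich : length V ≤ 2 * q * count P V
    many-rich = ∑-markov V (degree D) P n (2 * q) 1≤n
      (λ v → ≤-trans (count≤length (D v) (allFin n)) (≤-reflexive (length-allFin n)))
      (λ v ¬Pv → <⇒≤ (≰⇒> (¬Pv ∘ ≤⇒≤ᵇ)))
      (begin
        length V * (n + n)   ≡⟨ cong (_* (n + n)) length-vertices ⟩
        2 ^ n * (n + n)      ≡⟨ double (2 ^ n) n ⟩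
        2 * (2 ^ n * n)      ≤⟨ *-monoʳ-≤ 2 dense ⟩
        2 * (q * ∑ V (degree D)) ≡⟨ *-assoc 2 q _ ⟨
        2 * q * ∑ V (degree D)   ∎)
      where
      double : ∀ a b → a * (b + b) ≡ 2 * (a * b)
      double = solve-∀

    rich-power : ∀ v → n ^ k * ι (P v) ≤ (2 * q) ^ k * degree D v ^ k
    rich-power v with P v | ≤ᵇ⇒≤ n (2 * q * degree D v)
    ... | false | _  = ≤-trans (≤-reflexive (*-zeroʳ (n ^ k))) z≤n
    ... | true  | le = begin
      n ^ k * 1                      ≡⟨ *-identityʳ (n ^ k) ⟩
      n ^ k                          ≤⟨ ^-monoˡ-≤ k (le tt) ⟩
      (2 * q * degree D v) ^ k         ≡⟨ ^-distribʳ-* (2 * q) (degree D v) k ⟩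
      (2 * q) ^ k * degree D v ^ k     ∎

    -- Of the k + 1 factors 2 * q, one pays for restricting to rich vertices and k pay for the k-th
    -- power of a rich degree.
    average-good : length V * n ^ k ≤ ∑ V (λ b → (2 * q) ^ suc k * count (good D b) X)
    average-good = begin
      length V * n ^ k                                ≤⟨ *-monoˡ-≤ (n ^ k) many-rich ⟩
      2 * q * count P V * n ^ k                       ≡⟨ rotate (2 * q) (count P V) (n ^ k) ⟩
      2 * q * (n ^ k * count P V)                     ≡⟨ cong (2 * q *_) (∑-*ˡ V (n ^ k) _) ⟨
      2 * q * ∑ V (λ v → n ^ k * ι (P v))             ≤⟨ *-monoʳ-≤ (2 * q) (∑-mono V rich-power) ⟩
      2 * q * ∑ V (λ v → (2 * q) ^ k * degree D v ^ k)  ≡⟨ cong (2 * q *_) (∑-*ˡ V ((2 * q) ^ k) _) ⟩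
      2 * q * ((2 * q) ^ k * ∑ V (λ v → degree D v ^ k)) ≡⟨ *-assoc (2 * q) _ _ ⟨
      (2 * q) ^ suc k * ∑ V (λ v → degree D v ^ k)      ≡⟨ cong ((2 * q) ^ suc k *_) ∑-good ⟨
      (2 * q) ^ suc k * ∑ V (λ b → count (good D b) X) ≡⟨ ∑-*ˡ V ((2 * q) ^ suc k) (λ b → count (good D b) X) ⟨
      ∑ V (λ b → (2 * q) ^ suc k * count (good D b) X) ∎
      where
      rotate : ∀ a b c → a * b * c ≡ a * (c * b)
      rotate = solve-∀

    good-base : ∃[ b ] n ^ k ≤ (2 * q) ^ suc k * count (good D b) X
    good-base = proj₁ rich , subst (_≤ (2 * q) ^ suc k * count (good D (proj₁ rich)) X) (suc-pred (n ^ k)) (proj₂ (proj₂ rich))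
      where
      instance
        n^k≢0 : NonZero (n ^ k)
        n^k≢0 = m^n≢0 n k {{>-nonZero 1≤n}}

        length-V≢0 : NonZero (length V)
        length-V≢0 = subst NonZero (sym length-vertices) (m^n≢0 2 n)

      -- The pigeonhole is strict, so it is applied with threshold n ^ k - 1; positivity of n ^ k
      -- then restores the bound n ^ k.
      rich : ∃[ b ] b ∈ V × pred (n ^ k) < (2 * q) ^ suc k * count (good D b) X
      rich = ∑-pigeonhole V _ (pred (n ^ k))
        (<-≤-trans (*-monoʳ-< (length V) (≤-reflexive (suc-pred (n ^ k)))) average-good)

-- Edges of the cube as pairs of a vertex and a direction

bit : Bool → Bit
bit false = b0
bit true  = b1

-- The entry of the vertex in the given direction is discarded, so both endpoints of an edge produce
-- the same string.
edgeAt : ∀ {n} → Vertex n → Fin n → Vec Bit n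
edgeAt (b ∷ v) zero    = ⋆ ∷ Vec.map bit v
edgeAt (b ∷ v) (suc i) = bit b ∷ edgeAt v i

lowBit-bit : ∀ b → lowBit (bit b) ≡ b
lowBit-bit false = refl
lowBit-bit true  = refl

highBit-bit : ∀ b → highBit (bit b) ≡ b
highBit-bit false = refl
highBit-bit true  = refl

lo-bits : ∀ {n} (v : Vertex n) → lo (Vec.map bit v) ≡ v
lo-bits []      = refl
lo-bits (b ∷ v) = cong₂ _∷_ (lowBit-bit b) (lo-bits v)

hi-bits : ∀ {n} (v : Vertex n) → hi (Vec.map bit v) ≡ v
hi-bits []      = refl
hi-bits (b ∷ v) = cong₂ _∷_ (highBit-bit b) (hi-bits v)

edgeAt-joins : ∀ {n} (v : Vertex n) i → Joins (edgeAt v i) (flip i v) v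
edgeAt-joins (false ∷ v) zero = inj₂ (cong (false ∷_) (lo-bits v) , cong (true ∷_) (hi-bits v))
edgeAt-joins (true  ∷ v) zero = inj₁ (cong (false ∷_) (lo-bits v) , cong (true ∷_) (hi-bits v))
edgeAt-joins (b ∷ v) (suc i) with edgeAt-joins v i
... | inj₁ (l , h) = inj₁ (cong₂ _∷_ (lowBit-bit b) l , cong₂ _∷_ (highBit-bit b) h)
... | inj₂ (l , h) = inj₂ (cong₂ _∷_ (lowBit-bit b) l , cong₂ _∷_ (highBit-bit b) h)

bits-hi : ∀ {n} (e : Vec Bit n) → stars e ≡ 0 → Vec.map bit (hi e) ≡ e
bits-hi []       _    = refl
bits-hi (b0 ∷ e) none = cong (b0 ∷_) (bits-hi e none)
bits-hi (b1 ∷ e) none = cong (b1 ∷_) (bits-hi e none)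

lo≡hi : ∀ {n} (e : Vec Bit n) → stars e ≡ 0 → lo e ≡ hi e
lo≡hi e none = trans (cong lo (sym (bits-hi e none))) (lo-bits (hi e))

-- The upper endpoint determines e once the position of the flip-bit is known, since the two agree
-- everywhere else.
edgeAt-surjective : ∀ {n} (e : Vec Bit n) → IsEdge e → ∃[ i ] edgeAt (hi e) i ≡ e
edgeAt-surjective (b0 ∷ e) one with i , eq ← edgeAt-surjective e one = suc i , cong (b0 ∷_) eq
edgeAt-surjective (b1 ∷ e) one with i , eq ← edgeAt-surjective e one = suc i , cong (b1 ∷_) eq
edgeAt-surjective (⋆  ∷ e) one = zero , cong (⋆ ∷_) (bits-hi e (suc-injective one))

_≟ᵇ_ : (a b : Bit) → Dec (a ≡ b)
b0 ≟ᵇ b0 = yes refl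
b0 ≟ᵇ b1 = no λ ()
b0 ≟ᵇ ⋆  = no λ ()
b1 ≟ᵇ b0 = no λ ()
b1 ≟ᵇ b1 = yes refl
b1 ≟ᵇ ⋆  = no λ ()
⋆  ≟ᵇ b0 = no λ ()
⋆  ≟ᵇ b1 = no λ ()
⋆  ≟ᵇ ⋆  = yes refl

module _ {n} (F : CubeSubgraph n) where
  open import Data.List.Membership.DecPropositional (Vec.≡-dec {n = n} _≟ᵇ_) using (_∈?_)

  incident : Vertex n → Fin n → Bool
  incident v i = ⌊ edgeAt v i ∈? fedges F ⌋

  incident⇒joined : ∀ v i → T (incident v i) → Any (λ f → Joins f (flip i v) v) (fedges F)
  incident⇒joined v i t = lose (toWitness t) (edgeAt-joins v i)

  -- Each edge of F is charged to the incidence at its upper endpoint. Incidences at lower endpoints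
  -- only add to the right-hand side, at the cost of a constant factor.
  eF≤∑-degree : eF F ≤ ∑ (vertices n) (degree incident)
  eF≤∑-degree = begin
    eF F                                                      ≤⟨ Unique-⊆-length (fUnique F) covered ⟩
    length (map edge incidences)                              ≡⟨ length-map edge incidences ⟩
    length incidences                                         ≡⟨ length-filter-count inc pairs ⟩
    count inc pairs                                           ≡⟨ ∑-cartesianProductWith _,_ (vertices n) (allFin n) _ ⟩
    ∑ (vertices n) (degree incident)                          ∎
    where
    open ≤-Reasoning
    pairs = cartesianProduct (vertices n) (allFin n)

    edge : Vertex n × Fin n → Vec Bit n
    edge (v , i) = edgeAt v i

    inc : Vertex n × Fin n → Bool
    inc (v , i) = incident v i

    incidences = filter (T? ∘ inc) pairs

    covered : fedges F ⊆ map edge incidences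
    covered {f} f∈F with i , eq ← edgeAt-surjective f (All.lookup (fAreEdges F) f∈F) =
      subst (_∈ map edge incidences) eq (∈-map⁺ edge
        (∈-filter⁺ (T? ∘ inc) (∈-cartesianProduct⁺ (∈-vertices (hi f)) (∈-allFin i))
          (fromWitness (subst (_∈ fedges F) (sym eq) f∈F))))

-- Embedding Q_l along chosen directions

embed : ∀ {l n} → (Fin l → Fin n) → Vertex n → Vertex l → Vertex n
embed g v []      = v
embed g v (b ∷ y) = (if b then flip (g zero) else id) (embed (g ∘ suc) v y)

lookup-embed : ∀ {l n} (g : Fin l → Fin n) v y c → (∀ i → c ≢ g i) →
               lookup (embed g v y) c ≡ lookup v c
lookup-embed g v []          c c∉g = refl
lookup-embed g v (false ∷ y) c c∉g = lookup-embed (g ∘ suc) v y c (c∉g ∘ suc)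
lookup-embed g v (true  ∷ y) c c∉g = trans (Vec.lookup∘updateAt′ c (g zero) (c∉g zero) (embed (g ∘ suc) v y))
  (lookup-embed (g ∘ suc) v y c (c∉g ∘ suc))

-- The first entry of y can be read off from the image at coordinate `g zero`: as g is injective, no
-- later flip touches that coordinate, so it differs from v there exactly when the first entry is
-- `true`.
embed-injective : ∀ {l n} (g : Fin l → Fin n) v → Injective _≡_ _≡_ g → Injective _≡_ _≡_ (embed g v)
embed-injective g v g-inj {[]}    {[]}     _  = refl
embed-injective g v g-inj {b ∷ y} {b′ ∷ z} eq = cases b b′ eq
  where
  tail-inj : Injective _≡_ _≡_ (embed (g ∘ suc) v)
  tail-inj = embed-injective (g ∘ suc) v (Fin.suc-injective ∘ g-inj)

  at-g₀ : ∀ y → lookup (embed (g ∘ suc) v y) (g zero) ≡ lookup v (g zero)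
  at-g₀ y = lookup-embed (g ∘ suc) v y (g zero) (λ i eq → Fin.0≢1+n (g-inj eq))

  not-flipped : ∀ y z → embed (g ∘ suc) v y ≢ flip (g zero) (embed (g ∘ suc) v z)
  not-flipped y z eq = not-¬ (trans (at-g₀ y) (sym (at-g₀ z)))
    (trans (cong (λ w → lookup w (g zero)) eq) (Vec.lookup∘updateAt (g zero) (embed (g ∘ suc) v z)))

  cases : ∀ b b′ → embed g v (b ∷ y) ≡ embed g v (b′ ∷ z) → b ∷ y ≡ b′ ∷ z
  cases false false eq = cong (false ∷_) (tail-inj eq)
  cases true  true  eq = cong (true ∷_) (tail-inj (flip-injective (g zero) eq))
  cases false true  eq = contradiction eq (not-flipped y z)
  cases true  false eq = contradiction (sym eq) (not-flipped z y)

-- Non-zero positions and the images of the endpoints of an edge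

nonZeroPositions : ∀ {l} → Vec Bit l → List (Fin l)
nonZeroPositions []       = []
nonZeroPositions (b0 ∷ e) = map suc (nonZeroPositions e)
nonZeroPositions (b1 ∷ e) = zero ∷ map suc (nonZeroPositions e)
nonZeroPositions (⋆  ∷ e) = zero ∷ map suc (nonZeroPositions e)

length-nonZeroPositions : ∀ {l} (e : Vec Bit l) → length (nonZeroPositions e) ≡ nonZeros e
length-nonZeroPositions []       = refl
length-nonZeroPositions (b0 ∷ e) = trans (length-map suc (nonZeroPositions e)) (length-nonZeroPositions e)
length-nonZeroPositions (b1 ∷ e) = cong suc (trans (length-map suc (nonZeroPositions e)) (length-nonZeroPositions e))
length-nonZeroPositions (⋆  ∷ e) = cong suc (trans (length-map suc (nonZeroPositions e)) (length-nonZeroPositions e))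

Unique-zero∷map-suc : ∀ {n} {xs : List (Fin n)} → Unique xs → Unique (Fin.zero ∷ map suc xs)
Unique-zero∷map-suc {xs = xs} u =
  All.map⁺ (All.universal (λ _ ()) xs) ∷ Unique.map⁺ Fin.suc-injective u

Unique-nonZeroPositions : ∀ {l} (e : Vec Bit l) → Unique (nonZeroPositions e)
Unique-nonZeroPositions []       = []
Unique-nonZeroPositions (b0 ∷ e) = Unique.map⁺ Fin.suc-injective (Unique-nonZeroPositions e)
Unique-nonZeroPositions (b1 ∷ e) = Unique-zero∷map-suc (Unique-nonZeroPositions e)
Unique-nonZeroPositions (⋆  ∷ e) = Unique-zero∷map-suc (Unique-nonZeroPositions e)

∈-nonZeroPositions⁻ : ∀ {l} (e : Vec Bit l) {a} → a ∈ nonZeroPositions e → NonZeroBit (lookup e a)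
∈-nonZeroPositions⁻ (b1 ∷ e) (here refl) = tt
∈-nonZeroPositions⁻ (⋆  ∷ e) (here refl) = tt
∈-nonZeroPositions⁻ (b0 ∷ e) a∈         with b , b∈ , refl ← ∈-map⁻ suc a∈ = ∈-nonZeroPositions⁻ e b∈
∈-nonZeroPositions⁻ (b1 ∷ e) (there a∈) with b , b∈ , refl ← ∈-map⁻ suc a∈ = ∈-nonZeroPositions⁻ e b∈
∈-nonZeroPositions⁻ (⋆  ∷ e) (there a∈) with b , b∈ , refl ← ∈-map⁻ suc a∈ = ∈-nonZeroPositions⁻ e b∈

-- The flip-bit counts as 1 in the upper endpoint, whose ones are therefore exactly the non-zero
-- positions. This is why k-partiteness is phrased with non-zero bits.
embed-hi : ∀ {l n} (g : Fin l → Fin n) v e → embed g v (hi e) ≡ flips (map g (nonZeroPositions e)) v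
embed-hi g v []      = refl
embed-hi g v (a ∷ e) = cases a
  where
  tail : embed (g ∘ suc) v (hi e) ≡ flips (map g (map suc (nonZeroPositions e))) v
  tail = trans (embed-hi (g ∘ suc) v e)
    (cong (λ xs → flips xs v) (map-∘ {g = g} {f = suc} (nonZeroPositions e)))

  cases : ∀ a → embed g v (hi (a ∷ e)) ≡ flips (map g (nonZeroPositions (a ∷ e))) v
  cases b0 = tail
  cases b1 = cong (flip (g zero)) tail
  cases ⋆  = cong (flip (g zero)) tail

-- The position s is that of the flip-bit. It is itself non-zero, so `g s` occurs among the
-- directions flipped to reach the image of the upper endpoint.
embed-lo : ∀ {l n} (g : Fin l → Fin n) v e → IsEdge e →
  ∃[ s ] s ∈ nonZeroPositions e × embed g v (lo e) ≡ flip (g s) (embed g v (hi e))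
embed-lo g v (b0 ∷ e) one with s , s∈ , eq ← embed-lo (g ∘ suc) v e one = suc s , ∈-map⁺ suc s∈ , eq
embed-lo g v (b1 ∷ e) one with s , s∈ , eq ← embed-lo (g ∘ suc) v e one =
  suc s , there (∈-map⁺ suc s∈) , trans (cong (flip (g zero)) eq) (flip-comm (g zero) (g (suc s)) _)
embed-lo g v (⋆  ∷ e) one = zero , here refl ,
  trans (cong (embed (g ∘ suc) v) (lo≡hi e (suc-injective one))) (sym (flip-involutive (g zero) _))

-- From a box of good tuples to a copy of H

toList-tabulate : ∀ {n} (f : Fin n → A) → toList (Vec.tabulate f) ≡ tabulate f
toList-tabulate {n = zero}  f = refl
toList-tabulate {n = suc n} f = cong (f zero ∷_) (toList-tabulate (f ∘ suc))

box⇒copy : ∀ {l n k} (F : CubeSubgraph n) (H : SubCube l) → KPartite k H →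
           ∀ v → Box l (good {k = k} (incident F) v) → ContainsCopy F H
box⇒copy {l} {n} {k} F H (uniform , σ , rainbow) v box
  -- Several positions may share a colour and hence a part; parts of size l leave room for l
  -- distinct representatives.
  with g , g-inj , g∈ ← distinct-representatives Fin._≟_ l (λ i → lookup (Box.parts box) (σ i))
         (Box.unique box ∘ σ) (λ i → ≤-reflexive (sym (Box.size box (σ i))))
  = embed g v , (λ _ _ → embed-injective g v g-inj) , All.tabulate present
  where
  open Box box
  present : ∀ {e} → e ∈ edges H →
            Any (λ f → Joins f (embed g v (lo e)) (embed g v (hi e))) (fedges F)
  present {e} e∈H
    with τ , σ∘τ , τ↭ ← transversal σ (Unique-nonZeroPositions e)
           (trans (length-nonZeroPositions e) (All.lookup uniform e∈H))
           (λ a∈ b∈ → All.lookup rainbow e∈H _ _ (∈-nonZeroPositions⁻ e a∈) (∈-nonZeroPositions⁻ e b∈))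
    with s , s∈ , eq ← embed-lo g v e (All.lookup (areEdges H) e∈H)
    = subst (λ y → Any (λ f → Joins f y (embed g v (hi e))) (fedges F)) (sym eq)
        -- The image of `hi e` is v ⊕ x for a tuple x of the box. Goodness of x gives an F-edge
        -- there in every direction of x, in particular in direction `g s`.
        (incident⇒joined F (embed g v (hi e)) (g s)
          (subst (λ y → T (incident F y (g s))) (sym hi≡)
            (T-all _ (toList x) (complete x x∈parts) (∈-resp-↭ (↭-sym x↭) (∈-map⁺ g s∈)))))
    where
    x = Vec.tabulate (g ∘ τ)

    x↭ : toList x ↭ map g (nonZeroPositions e)
    x↭ = ↭-trans (↭-reflexive (trans (toList-tabulate (g ∘ τ)) (sym (map-tabulate τ g)))) (Perm.map⁺ g τ↭)

    hi≡ : embed g v (hi e) ≡ flips (toList x) v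
    hi≡ = trans (embed-hi g v e) (sym (flips-↭ x↭ v))

    x∈parts : ∀ j → lookup x j ∈ lookup parts j
    -- The entry `g (τ j)` lies in the part of colour `σ (τ j)`, which is j.
    x∈parts j rewrite Vec.lookup∘tabulate (g ∘ τ) j = subst (λ i → g (τ j) ∈ lookup parts i) (σ∘τ j) (g∈ (τ j))

-- Edge density and the extremal bound

2^n*n≡2*eQ : ∀ n → 2 ^ n * n ≡ 2 * eQ n
2^n*n≡2*eQ zero    = refl
2^n*n≡2*eQ (suc n) = regroup (2 ^ n) (suc n)
  where
  regroup : ∀ a b → 2 * a * b ≡ 2 * (b * a)
  regroup = solve-∀

many-edges⇒dense : ∀ {n} (F : CubeSubgraph n) p → eQ n < p * eF F →
                   2 ^ n * n ≤ 2 * p * ∑ (vertices n) (degree (incident F))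
many-edges⇒dense {n} F p many = begin
  2 ^ n * n                                       ≡⟨ 2^n*n≡2*eQ n ⟩
  2 * eQ n                                        ≤⟨ *-monoʳ-≤ 2 (<⇒≤ many) ⟩
  2 * (p * eF F)                                  ≡⟨ *-assoc 2 p (eF F) ⟨
  2 * p * eF F                                    ≤⟨ *-monoʳ-≤ (2 * p) (eF≤∑-degree F) ⟩
  2 * p * ∑ (vertices n) (degree (incident F))    ∎
  where open ≤-Reasoning

theorem1p1 : (l k : ℕ) → k ≥ 1 → (H : SubCube l) → KPartite k H →
    (p : ℕ) → p ≥ 1 → ∃ λ N → (n : ℕ) → n ≥ N → ScaledExBound n H p
theorem1p1 l k _ H kpartite p _
  -- More than e(Q_n)/p edges give a degree sum of at least 2^n n/(2p); with q = 2 * p, `good-base`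
  -- then yields good tuples of density at least 1/(2q)^(k+1).
  with N , 1≤N , boxes ← dense⇒box k l ((2 * (2 * p)) ^ suc k) = N , bound
  where
  bound : ∀ n → n ≥ N → ScaledExBound n H p
  bound n n≥N F no-copy with p * eF F ≤? eQ n
  ... | yes le = le
  ... | no ¬le
    with v , dense ← good-base (incident F) k (2 * p) (≤-trans 1≤N n≥N) (many-edges⇒dense F p (≰⇒> ¬le))
    = contradiction (box⇒copy F H kpartite v (boxes n n≥N (good (incident F) v) dense)) no-copy
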